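{- Let $n\ge 3$ and let $G$ be a unicyclic graph on $n$ vertices. (1) $\mathrm{irr}_t(G)\ge 0$, with equality if and only if $G\cong C_n$. (2) If moreover $n\ge 4$ and $G\not\cong C_n$, then $\mathrm{irr}_t(G)\ge 2n-2$. Equality holds if and only if the degree sequence of $G$ is $(3,2,\ldots,2,1)$, i.e. one vertex of degree $3$, $n-2$ vertices of degree $2$ and one vertex of degree $1$.
   Context: A unicyclic graph is a simple connected graph whose number of edges equals its number of vertices. For a graph $G=(V,E)$ and $w\in V$, $d_G(w)$ is the degree of $w$. The total irregularity is $\mathrm{irr}_t(G)=\frac12\sum_{x,y\in V}|d_G(x)-d_G(y)|$, where the sum runs over all ordered pairs of vertices. $C_n$ is the cycle on $n$ vertices. Degree sequences are listed in nonincreasing order. -}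

module Defs where

open import Data.Fin.Base using (Fin; toℕ)
open import Data.Fin.Properties using (_<?_)
open import Data.Fin.Permutation using (Permutation; _⟨$⟩ʳ_)
open import Data.Integer.Base using (+_)
open import Data.List.Base
  using (List; length; map; filter; allFin; cartesianProduct)
open import Data.Nat.ListAction using (sum)
open import Data.Nat.Base using (ℕ; suc; _≤_; s≤s; ∣_-_∣)
open import Data.Nat.Properties using (≤-decTotalOrder; 1+n≢n; _≟_)
open import Data.Product.Base using (_×_; _,_)
open import Data.Rational.Base using (ℚ; ½; _/_; _*_)
open import Data.Sum.Base using (_⊎_; inj₁; inj₂; swap)
open import Function.Bundles using (_⇔_)
open import Level using (0ℓ)
open import Relation.Binary.Construct.Closure.ReflexiveTransitive using (Star)
open import Relation.Binary.Core using (Rel)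
open import Relation.Binary.Definitions using (Decidable; Symmetric)
open import Relation.Binary.PropositionalEquality.Core using (_≡_; sym; trans; cong)
open import Relation.Binary.Properties.DecTotalOrder ≤-decTotalOrder
  using (≥-decTotalOrder)
open import Relation.Nullary.Decidable using (_×-dec_; _⊎-dec_)
open import Relation.Nullary.Negation.Core using (¬_)
import Data.List.Sort as Sort

record Graph (n : ℕ) : Set₁ where
  field
    Adj        : Rel (Fin n) 0ℓ
    adj?       : Decidable Adj
    adj-sym    : Symmetric Adj
    adj-irrefl : ∀ {v} → ¬ Adj v v

open Graph public

module _ {n : ℕ} (G : Graph n) where

  degree : Fin n → ℕ
  degree w = length (filter (adj? G w) (allFin n))

  -- Each edge {u , v} is listed once, as the pair with u < v.
  edges : List (Fin n × Fin n)
  edges = filter (λ (u , v) → u <? v ×-dec adj? G u v)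
                 (cartesianProduct (allFin n) (allFin n))

  Connected : Set
  Connected = ∀ u v → Star (Adj G) u v

  Unicyclic : Set
  Unicyclic = Connected × length edges ≡ n

  degreeSequence : List ℕ
  degreeSequence = Sort.sort ≥-decTotalOrder (map degree (allFin n))

fromℕ : ℕ → ℚ
fromℕ k = + k / 1

irrₜ : ∀ {n} → Graph n → ℚ
irrₜ {n} G = ½ * fromℕ (sum (map (λ (x , y) → ∣ degree G x - degree G y ∣)
                                 (cartesianProduct (allFin n) (allFin n))))

infix 4 _≅_

record _≅_ {m n : ℕ} (G : Graph m) (H : Graph n) : Set where
  field
    bijection : Permutation m n
    adj⇔      : ∀ u v →
                Adj G u v ⇔ Adj H (bijection ⟨$⟩ʳ u) (bijection ⟨$⟩ʳ v)

-- j is the successor of i modulo n.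
Next : ∀ {n} → Rel (Fin n) 0ℓ
Next {n} i j = toℕ j ≡ suc (toℕ i) ⊎ (suc (toℕ i) ≡ n × toℕ j ≡ 0)

next? : ∀ {n} → Decidable (Next {n})
next? {n} i j =
  (toℕ j ≟ suc (toℕ i)) ⊎-dec ((suc (toℕ i) ≟ n) ×-dec (toℕ j ≟ 0))

next-irrefl : ∀ {n} → 3 ≤ n → {i : Fin n} → ¬ Next i i
next-irrefl _               (inj₁ i≡1+i)      = 1+n≢n (sym i≡1+i)
next-irrefl (s≤s (s≤s _)) (inj₂ (eq , i≡0)) with () ← trans (sym eq) (cong suc i≡0)

cycle : (n : ℕ) → 3 ≤ n → Graph n
cycle n 3≤n = record
  { Adj        = λ i j → Next i j ⊎ Next j i
  ; adj?       = λ i j → next? i j ⊎-dec next? j i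
  ; adj-sym    = swap
  ; adj-irrefl = λ { (inj₁ p) → next-irrefl 3≤n p ; (inj₂ p) → next-irrefl 3≤n p }
  }

{-# OPTIONS --safe #-}
module Submission where

-- A connected graph with n edges has degree sum 2n, so the row sum Σ_y |d(x) − d(y)| is at least
-- |n d(x) − 2n| = n |d(x) − 2|. Writing u for the total deficit Σ (2 ∸ d(x)), which equals the
-- total excess Σ (d(x) ∸ 2), the ordered double sum is therefore at least 2nu. If u = 0 all
-- degrees are 2, and a non-backtracking walk traces out a cycle exhausting the graph; if u = 1
-- the degrees are 3, 2, …, 2, 1 and the double sum is exactly 4n − 4; if u ≥ 2 it is at least 4n.

open import Defs
import Data.Integer.Base as ℤ
import Data.Integer.Properties as ℤ
open import Data.Bool.Base using (if_then_else_)
open import Data.Fin.Base as Fin using (Fin; zero; suc; toℕ; fromℕ<)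
open import Data.Fin.Permutation using (permutation; _⟨$⟩ʳ_; _⟨$⟩ˡ_; inverseʳ; inverseˡ)
import Data.Fin.Properties as Fin
open import Data.List.Base
  using (List; _∷_; []; _++_; replicate; map; filter; length; allFin; cartesianProduct)
open import Data.List.Membership.Propositional using (_∈_)
open import Data.List.Membership.Propositional.Properties
  using (∈-allFin; ∈-filter⁺; ∈-filter⁻; ∈-map⁺)
open import Data.List.Membership.Propositional.Properties.WithK using (unique∧set⇒bag)
open import Data.List.Properties
  using (map-∘; map-cong; map-++; length-map; length-tabulate; length-replicate; length-++;
         ++-assoc; ++-identityʳ)
open import Data.List.Relation.Binary.BagAndSetEquality using (∼bag⇒↭)
open import Data.List.Relation.Binary.Permutation.Propositional
  using (_↭_; ↭-refl; ↭-sym; ↭-trans; ↭-reflexive; prep; ↭⇒↭ₛ)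
open import Data.List.Relation.Binary.Permutation.Propositional.Properties
  using (map⁺; ↭-length; shift; ++-comm)
open import Data.List.Relation.Binary.Pointwise using (Pointwise-≡⇒≡)
open import Data.List.Relation.Unary.All using ([]; _∷_)
open import Data.List.Relation.Unary.AllPairs using ([]; _∷_)
open import Data.List.Relation.Unary.Any using (here; there)
open import Data.List.Relation.Unary.Linked using ([-]; _∷_)
open import Data.List.Relation.Unary.Sorted.TotalOrder using (Sorted)
open import Data.List.Relation.Unary.Sorted.TotalOrder.Properties using (↗↭↗⇒≋)
open import Data.List.Relation.Unary.Unique.Propositional using (Unique)
open import Data.List.Relation.Unary.Unique.Propositional.Properties using (allFin⁺; filter⁺)
import Data.List.Sort as Sort
open import Data.Nat.Base
  using (ℕ; zero; suc; _≤_; _<_; _+_; _*_; _∸_; ∣_-_∣; z≤n; s≤s; z<s; s≤s⁻¹; s<s⁻¹)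
open import Data.Nat.ListAction using (sum)
open import Data.Nat.ListAction.Properties using (sum-++; sum-↭)
open import Data.Nat.Properties
open import Data.Nat.Tactic.RingSolver using (solve-∀)
open import Data.Product.Base using (_×_; _,_; ∃-syntax; ∃₂; proj₁; proj₂)
open import Data.Rational.Base as ℚ using (0ℚ; ½; toℚᵘ) renaming (_≥_ to _≥ℚ_)
import Data.Rational.Properties as ℚ
import Data.Rational.Unnormalised.Base as ℚᵘ
import Data.Rational.Unnormalised.Properties as ℚᵘ
open import Data.Sum.Base using (_⊎_; inj₁; inj₂; swap; [_,_]′)
open import Function.Base using (_∘_; id)
open import Function.Bundles using (_⇔_; mk⇔; Equivalence)
open import Level using (0ℓ)
open import Relation.Binary.Bundles using (DecTotalOrder)
open import Relation.Binary.Construct.Closure.ReflexiveTransitive using (Star; ε; _◅_)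
open import Relation.Binary.Definitions using (Tri; tri<; tri≈; tri>)
open import Relation.Binary.Properties.DecTotalOrder ≤-decTotalOrder using (≥-decTotalOrder)
open import Relation.Binary.PropositionalEquality
  using (_≡_; _≢_; refl; sym; trans; cong; cong₂; subst; subst₂; ≢-sym; module ≡-Reasoning)
open import Relation.Nullary using (Dec; yes; no; ¬_; does; contradiction)
open import Relation.Nullary.Decidable using (_×-dec_; dec-true; dec-false)
open import Relation.Unary using (Pred; Decidable)

-- Finite sums over lists and the handshake lemma

∑ : {A : Set} → List A → (A → ℕ) → ℕ
∑ xs f = sum (map f xs)

∑-cong : {A : Set} {f g : A → ℕ} (xs : List A) → (∀ x → f x ≡ g x) → ∑ xs f ≡ ∑ xs g
∑-cong xs f≗g = cong sum (map-cong f≗g xs)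

∑-mono-≤ : {A : Set} {f g : A → ℕ} (xs : List A) → (∀ x → f x ≤ g x) → ∑ xs f ≤ ∑ xs g
∑-mono-≤ []       f≤g = z≤n
∑-mono-≤ (x ∷ xs) f≤g = +-mono-≤ (f≤g x) (∑-mono-≤ xs f≤g)

∑-zero : {A : Set} (xs : List A) → ∑ xs (λ _ → 0) ≡ 0
∑-zero []       = refl
∑-zero (_ ∷ xs) = ∑-zero xs

∑-distrib-+ : {A : Set} (f g : A → ℕ) (xs : List A) →
              ∑ xs (λ x → f x + g x) ≡ ∑ xs f + ∑ xs g
∑-distrib-+ f g []       = refl
∑-distrib-+ f g (x ∷ xs) = trans (cong ((f x + g x) +_) (∑-distrib-+ f g xs))
                                 (+-+-interchange (f x) (g x) (∑ xs f) (∑ xs g))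
  where
  +-+-interchange : ∀ a b c d → a + b + (c + d) ≡ a + c + (b + d)
  +-+-interchange = solve-∀

∑-distribˡ-* : {A : Set} (c : ℕ) (f : A → ℕ) (xs : List A) →
               ∑ xs (λ x → c * f x) ≡ c * ∑ xs f
∑-distribˡ-* c f []       = sym (*-zeroʳ c)
∑-distribˡ-* c f (x ∷ xs) = trans (cong (c * f x +_) (∑-distribˡ-* c f xs))
                                  (sym (*-distribˡ-+ c (f x) (∑ xs f)))

∑-swap : {A B : Set} (f : A → B → ℕ) (xs : List A) (ys : List B) →
         ∑ xs (λ x → ∑ ys (f x)) ≡ ∑ ys (λ y → ∑ xs (λ x → f x y))
∑-swap f []       ys = sym (∑-zero ys)
∑-swap f (x ∷ xs) ys = trans (cong (∑ ys (f x) +_) (∑-swap f xs ys))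
                             (sym (∑-distrib-+ (f x) (λ y → ∑ xs (λ z → f z y)) ys))

∑-map : {A B : Set} (f : B → ℕ) (g : A → B) (xs : List A) → ∑ (map g xs) f ≡ ∑ xs (f ∘ g)
∑-map f g xs = cong sum (sym (map-∘ xs))

∑-++ : {A : Set} (f : A → ℕ) (xs ys : List A) → ∑ (xs ++ ys) f ≡ ∑ xs f + ∑ ys f
∑-++ f xs ys = trans (cong sum (map-++ f xs ys)) (sum-++ (map f xs) (map f ys))

∑-replicate : {A : Set} (f : A → ℕ) (k : ℕ) (x : A) → ∑ (replicate k x) f ≡ k * f x
∑-replicate f zero    x = refl
∑-replicate f (suc k) x = cong (f x +_) (∑-replicate f k x)

∑-↭ : {A : Set} (f : A → ℕ) {xs ys : List A} → xs ↭ ys → ∑ xs f ≡ ∑ ys f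
∑-↭ f xs↭ys = sum-↭ (map⁺ f xs↭ys)

∑-cartesianProduct : {A B : Set} (f : A × B → ℕ) (xs : List A) (ys : List B) →
                     ∑ (cartesianProduct xs ys) f ≡ ∑ xs (λ x → ∑ ys (λ y → f (x , y)))
∑-cartesianProduct f []       ys = refl
∑-cartesianProduct f (x ∷ xs) ys = begin
  ∑ (map (x ,_) ys ++ cartesianProduct xs ys) f
    ≡⟨ ∑-++ f (map (x ,_) ys) _ ⟩
  ∑ (map (x ,_) ys) f + ∑ (cartesianProduct xs ys) f
    ≡⟨ cong₂ _+_ (∑-map f (x ,_) ys) (∑-cartesianProduct f xs ys) ⟩
  ∑ ys (λ y → f (x , y)) + ∑ xs (λ z → ∑ ys (λ y → f (z , y)))
    ∎
  where open ≡-Reasoning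

𝟙 : {P : Set} → Dec P → ℕ
𝟙 p? = if does p? then 1 else 0

𝟙-true : {P : Set} (p? : Dec P) → P → 𝟙 p? ≡ 1
𝟙-true p? p rewrite dec-true p? p = refl

𝟙-false : {P : Set} (p? : Dec P) → ¬ P → 𝟙 p? ≡ 0
𝟙-false p? ¬p rewrite dec-false p? ¬p = refl

length-filter-∑ : {A : Set} {P : Pred A 0ℓ} (P? : Decidable P) (xs : List A) →
                  length (filter P? xs) ≡ ∑ xs (λ x → 𝟙 (P? x))
length-filter-∑ P? []       = refl
length-filter-∑ P? (x ∷ xs) with P? x
... | yes _ = cong suc (length-filter-∑ P? xs)
... | no  _ = length-filter-∑ P? xs

module _ {n : ℕ} (G : Graph n) where

  private
    e? : ∀ u v → Dec (u Fin.< v × Adj G u v)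
    e? u v = u Fin.<? v ×-dec adj? G u v

  -- By trichotomy the endpoints of an edge come in exactly one of the two orders; looplessness
  -- excludes equality.
  𝟙-adj : ∀ u v → 𝟙 (adj? G u v) ≡ 𝟙 (e? u v) + 𝟙 (e? v u)
  𝟙-adj u v = split (adj? G u v) (Fin.<-cmp u v)
    where
    split : (uv? : Dec (Adj G u v)) → Tri (u Fin.< v) (u ≡ v) (v Fin.< u) →
            𝟙 uv? ≡ 𝟙 (e? u v) + 𝟙 (e? v u)
    split (no ¬uv) _                = sym (cong₂ _+_ (𝟙-false (e? u v) λ (_ , uv) → ¬uv uv)
                                                     (𝟙-false (e? v u) λ (_ , vu) → ¬uv (adj-sym G vu)))
    split (yes uv) (tri< u<v _ u≯v) = sym (cong₂ _+_ (𝟙-true (e? u v) (u<v , uv))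
                                                     (𝟙-false (e? v u) λ (v<u , _) → u≯v v<u))
    split (yes uv) (tri≈ _ refl _)  = contradiction uv (adj-irrefl G)
    split (yes uv) (tri> u≮v _ v<u) = sym (cong₂ _+_ (𝟙-false (e? u v) λ (u<v , _) → u≮v u<v)
                                                     (𝟙-true (e? v u) (v<u , adj-sym G uv)))

  -- Handshake lemma: degrees are row sums of the adjacency indicator, which splits into its part
  -- with u < v and the transpose.
  ∑-degree : ∑ (allFin n) (degree G) ≡ 2 * length (edges G)
  ∑-degree = begin
    ∑ V (degree G)
      ≡⟨ ∑-cong V (λ u → length-filter-∑ (adj? G u) V) ⟩
    ∑ V (λ u → ∑ V (λ v → 𝟙 (adj? G u v)))
      ≡⟨ ∑-cong V (λ u → trans (∑-cong V (𝟙-adj u)) (∑-distrib-+ _ _ V)) ⟩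
    ∑ V (λ u → ∑ V (λ v → 𝟙 (e? u v)) + ∑ V (λ v → 𝟙 (e? v u)))
      ≡⟨ ∑-distrib-+ _ _ V ⟩
    E + ∑ V (λ u → ∑ V (λ v → 𝟙 (e? v u)))
      -- Exchanging the sums turns the transposed part into `E` itself.
      ≡⟨ cong (E +_) (∑-swap (λ u v → 𝟙 (e? v u)) V V) ⟩
    E + E
      ≡⟨ cong (λ k → k + k) E≡∣edges∣ ⟩
    length (edges G) + length (edges G)
      ≡⟨ cong (length (edges G) +_) (sym (+-identityʳ _)) ⟩
    2 * length (edges G)
      ∎
    where
    open ≡-Reasoning
    V = allFin n
    E = ∑ V (λ u → ∑ V (λ v → 𝟙 (e? u v)))
    E≡∣edges∣ : E ≡ length (edges G)
    E≡∣edges∣ = sym (trans (length-filter-∑ _ (cartesianProduct V V))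
                           (∑-cartesianProduct _ V V))

-- The spread of a list with mean 2

-- On a list of degrees this is the ordered double sum, twice the total irregularity.
spread : List ℕ → ℕ
spread ds = ∑ ds (λ x → ∑ ds ∣ x -_∣)

-- Truncated subtraction splits d - 2 into its negative and positive parts, which add up to |d - 2|.
deficit excess : List ℕ → ℕ
deficit ds = ∑ ds (2 ∸_)
excess ds  = ∑ ds (_∸ 2)

spread-↭ : ∀ {ds es} → ds ↭ es → spread ds ≡ spread es
spread-↭ {ds} {es} ds↭es =
  trans (∑-cong ds (λ x → ∑-↭ ∣ x -_∣ ds↭es)) (∑-↭ (λ x → ∑ es ∣ x -_∣) ds↭es)

-- Subtraction-free form of Σ (d - 2) = excess - deficit; termwise both sides are max(d, 2).
sum+deficit : ∀ ds → sum ds + deficit ds ≡ 2 * length ds + excess ds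
sum+deficit []       = refl
sum+deficit (d ∷ ds) = begin
  d + sum ds + ((2 ∸ d) + deficit ds)        ≡⟨ interchange d (sum ds) (2 ∸ d) _ ⟩
  (d + (2 ∸ d)) + (sum ds + deficit ds)      ≡⟨ cong₂ _+_ (pointwise d) (sum+deficit ds) ⟩
  (2 + (d ∸ 2)) + (2 * length ds + excess ds) ≡⟨ regroup (d ∸ 2) (length ds) (excess ds) ⟩
  2 * suc (length ds) + ((d ∸ 2) + excess ds) ∎
  where
  open ≡-Reasoning
  interchange : ∀ a b c e → a + b + (c + e) ≡ (a + c) + (b + e)
  interchange = solve-∀
  regroup : ∀ a b c → (2 + a) + (2 * b + c) ≡ 2 * suc b + (a + c)
  regroup = solve-∀
  pointwise : ∀ d → d + (2 ∸ d) ≡ 2 + (d ∸ 2)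
  pointwise 0             = refl
  pointwise 1             = refl
  pointwise (suc (suc d)) = trans (cong (2 + d +_) (0∸n≡0 d)) (+-identityʳ _)

deficit≡excess : ∀ ds → sum ds ≡ 2 * length ds → deficit ds ≡ excess ds
deficit≡excess ds Σ≡ = +-cancelˡ-≡ (2 * length ds) _ _
  (trans (cong (_+ deficit ds) (sym Σ≡)) (sum+deficit ds))

-- The triangle inequality for Σ (x - d), peeling off one entry at a time.
∣length*x-sum∣≤ : ∀ x ds → ∣ length ds * x - sum ds ∣ ≤ ∑ ds ∣ x -_∣
∣length*x-sum∣≤ x []       = ≤-refl
∣length*x-sum∣≤ x (d ∷ ds) = begin
  -- The intermediate point `d + L` exchanges first x for d, then L for S.
  ∣ x + L - d + S ∣                        ≤⟨ ∣-∣-triangle (x + L) (d + L) (d + S) ⟩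
  ∣ x + L - d + L ∣ + ∣ d + L - d + S ∣    ≡⟨ cong₂ _+_ cancelʳ (∣m+n-m+o∣≡∣n-o∣ d L S) ⟩
  ∣ x - d ∣ + ∣ L - S ∣                    ≤⟨ +-monoʳ-≤ ∣ x - d ∣ (∣length*x-sum∣≤ x ds) ⟩
  ∣ x - d ∣ + ∑ ds ∣ x -_∣                 ∎
  where
  open ≤-Reasoning
  L = length ds * x
  S = sum ds
  cancelʳ : ∣ x + L - d + L ∣ ≡ ∣ x - d ∣
  cancelʳ = trans (cong₂ ∣_-_∣ (+-comm x L) (+-comm d L)) (∣m+n-m+o∣≡∣n-o∣ L x d)

length*∣x-2∣≤ : ∀ {ds} x → sum ds ≡ 2 * length ds →
                length ds * ((2 ∸ x) + (x ∸ 2)) ≤ ∑ ds ∣ x -_∣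
length*∣x-2∣≤ {ds} x Σ≡ = begin
  length ds * ((2 ∸ x) + (x ∸ 2))      ≡⟨ cong (length ds *_) (abs x) ⟩
  length ds * ∣ x - 2 ∣                ≡⟨ *-distribˡ-∣-∣ (length ds) x 2 ⟩
  ∣ length ds * x - length ds * 2 ∣    ≡⟨ cong ∣ length ds * x -_∣ (trans (*-comm (length ds) 2) (sym Σ≡)) ⟩
  ∣ length ds * x - sum ds ∣           ≤⟨ ∣length*x-sum∣≤ x ds ⟩
  ∑ ds ∣ x -_∣                         ∎
  where
  open ≤-Reasoning
  abs : ∀ x → (2 ∸ x) + (x ∸ 2) ≡ ∣ x - 2 ∣
  abs 0             = refl
  abs 1             = refl
  abs (suc (suc x)) = trans (cong (_+ x) (0∸n≡0 x)) (sym (∣-∣-identityʳ x))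

-- Summing the row bounds leaves the length times Σ |x - 2|, and that sum is deficit plus excess,
-- two equal numbers.
spread-lower : ∀ ds → sum ds ≡ 2 * length ds → length ds * (2 * deficit ds) ≤ spread ds
spread-lower ds Σ≡ = begin
  length ds * (2 * deficit ds)                         ≡⟨ cong (length ds *_) 2*deficit≡ ⟩
  length ds * (deficit ds + excess ds)                 ≡⟨ cong (length ds *_) (∑-distrib-+ (2 ∸_) (_∸ 2) ds) ⟨
  length ds * ∑ ds (λ x → (2 ∸ x) + (x ∸ 2))           ≡⟨ ∑-distribˡ-* (length ds) _ ds ⟨
  ∑ ds (λ x → length ds * ((2 ∸ x) + (x ∸ 2)))         ≤⟨ ∑-mono-≤ ds (λ x → length*∣x-2∣≤ {ds} x Σ≡) ⟩
  spread ds                                            ∎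
  where
  open ≤-Reasoning
  2*deficit≡ : 2 * deficit ds ≡ deficit ds + excess ds
  2*deficit≡ = cong (deficit ds +_) (trans (+-identityʳ _) (deficit≡excess ds Σ≡))

-- At most one entry can lie below 2, and it is a 1; at most one can lie above, and it is a 3. The
-- blocks are ordered to match `extremal`.
↭-by-deviation : ∀ ds → deficit ds ≤ 1 → excess ds ≤ 1 →
  ∃[ k ] ds ↭ replicate (excess ds) 3 ++ replicate k 2 ++ replicate (deficit ds) 1
↭-by-deviation []       _ _ = 0 , ↭-refl
-- An entry 0 alone contributes 2 to the deficit.
↭-by-deviation (0 ∷ ds) (s≤s ()) _
↭-by-deviation (1 ∷ ds) (s≤s def≤0) exc≤1
  with k , ds↭ ← ↭-by-deviation ds (m≤n⇒m≤1+n def≤0) exc≤1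
  -- No deficit is left for the tail, so it has no ones and the new 1 can move to the end.
  rewrite n≤0⇒n≡0 def≤0
  = k , ↭-trans (prep 1 ds↭) (↭-trans (++-comm (1 ∷ []) _)
          (↭-reflexive (trans (++-assoc threes _ _)
            (cong (λ l → threes ++ l ++ 1 ∷ []) (++-identityʳ _)))))
  where threes = replicate (excess ds) 3
↭-by-deviation (2 ∷ ds) def≤1 exc≤1
  with k , ds↭ ← ↭-by-deviation ds def≤1 exc≤1
  = suc k , ↭-trans (prep 2 ds↭) (↭-sym (shift 2 (replicate (excess ds) 3) _))
↭-by-deviation (3 ∷ ds) def≤1 (s≤s exc≤0)
  with k , ds↭ ← ↭-by-deviation ds def≤1 (m≤n⇒m≤1+n exc≤0)
  = k , prep 3 ds↭
-- An entry of at least 4 contributes at least 2 to the excess.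
↭-by-deviation (suc (suc (suc (suc d))) ∷ ds) _ (s≤s ())

extremal : ℕ → List ℕ
extremal n = 3 ∷ replicate (n ∸ 2) 2 ++ 1 ∷ []

∈⇒≤∑ : {A : Set} (f : A → ℕ) {x : A} {xs : List A} → x ∈ xs → f x ≤ ∑ xs f
∈⇒≤∑ f (here refl)  = m≤m+n _ _
∈⇒≤∑ f (there x∈xs) = ≤-trans (∈⇒≤∑ f x∈xs) (m≤n+m _ _)

-- The summands 2 ∸ d and d ∸ 2 are each bounded by a total that vanishes.
deficit≡0⇒≡2 : ∀ {ds d} → sum ds ≡ 2 * length ds → deficit ds ≡ 0 → d ∈ ds → d ≡ 2
deficit≡0⇒≡2 {ds} {d} Σ≡ def≡0 d∈ds = ≤-antisym
  (m∸n≡0⇒m≤n (n≤0⇒n≡0 (subst (d ∸ 2 ≤_) (trans (sym (deficit≡excess ds Σ≡)) def≡0)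
                               (∈⇒≤∑ (_∸ 2) d∈ds))))
  (m∸n≡0⇒m≤n (n≤0⇒n≡0 (subst (2 ∸ d ≤_) def≡0 (∈⇒≤∑ (2 ∸_) d∈ds))))

spread-const : {A : Set} (f : A → ℕ) {c : ℕ} (xs : List A) → (∀ x → f x ≡ c) →
               spread (map f xs) ≡ 0
spread-const f {c} xs f≗c = begin
  spread (map f xs)                        ≡⟨ ∑-map _ f xs ⟩
  ∑ xs (λ x → ∑ (map f xs) ∣ f x -_∣)      ≡⟨ ∑-cong xs (λ x → ∑-map ∣ f x -_∣ f xs) ⟩
  ∑ xs (λ x → ∑ xs (λ y → ∣ f x - f y ∣))  ≡⟨ ∑-cong xs (λ x → trans (∑-cong xs (∣fx-fy∣≡0 x)) (∑-zero xs)) ⟩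
  ∑ xs (λ _ → 0)                           ≡⟨ ∑-zero xs ⟩
  0                                        ∎
  where
  open ≡-Reasoning
  ∣fx-fy∣≡0 : ∀ x y → ∣ f x - f y ∣ ≡ 0
  ∣fx-fy∣≡0 x y = m≡n⇒∣m-n∣≡0 (trans (f≗c x) (sym (f≗c y)))

extremal↗ : ∀ n → Sorted (DecTotalOrder.totalOrder ≥-decTotalOrder) (extremal n)
extremal↗ n = go (n ∸ 2) (m≤n+m 2 1)
  where
  -- Allowing any head d ≥ 2 lets one induction cover the leading 3 and every later 2.
  go : ∀ k {d} → 2 ≤ d →
       Sorted (DecTotalOrder.totalOrder ≥-decTotalOrder) (d ∷ replicate k 2 ++ 1 ∷ [])
  go zero    2≤d = ≤-trans (n≤1+n 1) 2≤d ∷ [-]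
  go (suc k) 2≤d = 2≤d ∷ go k ≤-refl

spread-extremal : ∀ {n} → 2 ≤ n → spread (extremal n) ≡ 2 * (2 * n ∸ 2)
spread-extremal {suc (suc k)} (s≤s (s≤s _)) = begin
  spread (extremal (2 + k))
    ≡⟨ ∑-extremal _ ⟩
  ∑ (extremal (2 + k)) ∣ 3 -_∣ + (k * ∑ (extremal (2 + k)) ∣ 2 -_∣ + ∑ (extremal (2 + k)) ∣ 1 -_∣)
    ≡⟨ cong₂ _+_ (∑-extremal ∣ 3 -_∣) (cong₂ (λ a b → k * a + b) (∑-extremal ∣ 2 -_∣) (∑-extremal ∣ 1 -_∣)) ⟩
  -- Row sums: k + 2 for the 3, then 2 for each of the k twos, then 2 + k for the 1.
  (0 + (k * 1 + 2)) + (k * (1 + (k * 0 + 1)) + (2 + (k * 1 + 0)))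
    ≡⟨ total k ⟩
  2 * (2 + 2 * k)
    ≡⟨ cong (λ l → 2 * (l ∸ 2)) (*-distribˡ-+ 2 2 k) ⟨
  2 * (2 * (2 + k) ∸ 2)
    ∎
  where
  open ≡-Reasoning
  ∑-extremal : ∀ f → ∑ (extremal (2 + k)) f ≡ f 3 + (k * f 2 + f 1)
  ∑-extremal f = cong (f 3 +_) (trans (∑-++ f (replicate k 2) _)
    (cong₂ _+_ (∑-replicate f k 2) (+-identityʳ _)))
  total : ∀ k → (0 + (k * 1 + 2)) + (k * (1 + (k * 0 + 1)) + (2 + (k * 1 + 0))) ≡ 2 * (2 + 2 * k)
  total = solve-∀

deficit≡1⇒↭extremal : ∀ ds → sum ds ≡ 2 * length ds → deficit ds ≡ 1 → ds ↭ extremal (length ds)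
deficit≡1⇒↭extremal ds Σ≡ def≡1
  with exc≡1 ← trans (sym (deficit≡excess ds Σ≡)) def≡1
  with k , ds↭ ← ↭-by-deviation ds (≤-reflexive def≡1) (≤-reflexive exc≡1)
  rewrite def≡1 | exc≡1
  = subst (λ l → ds ↭ 3 ∷ replicate l 2 ++ 1 ∷ []) (sym ∣ds∣∸2≡k) ds↭
  where
  -- The length fixes the number of twos, since the 3 and the 1 account for two entries.
  ∣ds∣∸2≡k : length ds ∸ 2 ≡ k
  ∣ds∣∸2≡k = begin
    length ds ∸ 2                                    ≡⟨ cong (_∸ 2) (↭-length ds↭) ⟩
    length (replicate k 2 ++ 1 ∷ []) ∸ 1             ≡⟨ cong (_∸ 1) (length-++ (replicate k 2)) ⟩
    length (replicate k 2) + 1 ∸ 1                   ≡⟨ m+n∸n≡m _ 1 ⟩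
    length (replicate k 2)                           ≡⟨ length-replicate k ⟩
    k                                                ∎
    where open ≡-Reasoning

-- Deficit 1 forces the extremal list; deficit at least 2 gives spread at least 4n by
-- `spread-lower`, beyond 4n - 4.
spread-gap : ∀ ds → 2 ≤ length ds → sum ds ≡ 2 * length ds → deficit ds ≢ 0 →
             2 * (2 * length ds ∸ 2) < spread ds ⊎ ds ↭ extremal (length ds)
spread-gap ds 2≤n Σ≡ def≢0 with deficit ds in def≡
... | 0           = contradiction refl def≢0
... | 1           = inj₂ (deficit≡1⇒↭extremal ds Σ≡ def≡)
... | suc (suc a) = inj₁ (begin-strict
  -- Truncated subtraction of 2 is a strict decrease here because 2 ≤ 2n.
  2 * (2 * n ∸ 2)             <⟨ *-monoʳ-< 2 (∸-monoʳ-< z<s (≤-trans 2≤n (m≤m+n n _))) ⟩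
  2 * (2 * n)                 ≡⟨ rearrange n ⟩
  n * (2 * 2)                 ≤⟨ *-monoʳ-≤ n (*-monoʳ-≤ 2 {2} {2 + a} (m≤m+n 2 a)) ⟩
  n * (2 * (2 + a))           ≡⟨ cong (λ k → n * (2 * k)) def≡ ⟨
  n * (2 * deficit ds)        ≤⟨ spread-lower ds Σ≡ ⟩
  spread ds                   ∎)
  where
  open ≤-Reasoning
  n = length ds
  rearrange : ∀ n → 2 * (2 * n) ≡ n * (2 * 2)
  rearrange = solve-∀

-- Halving: passing between rationals and natural numbers

fromℕ-mono-≤ : ∀ {k l} → k ≤ l → fromℕ k ℚ.≤ fromℕ l
fromℕ-mono-≤ {k} {l} k≤l = ℚ.toℚᵘ-cancel-≤ (begin
  -- `_/_` reduces to lowest terms, so the comparison is made on the unnormalised fractions with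
  -- denominator 1.
  toℚᵘ (fromℕ k)        ≃⟨ ℚ.toℚᵘ-fromℚᵘ (ℚᵘ.mkℚᵘ (ℤ.+ k) 0) ⟩
  ℚᵘ.mkℚᵘ (ℤ.+ k) 0     ≤⟨ ℚᵘ.*≤* (ℤ.*-monoʳ-≤-nonNeg (ℤ.+ 1) (ℤ.+≤+ k≤l)) ⟩
  ℚᵘ.mkℚᵘ (ℤ.+ l) 0     ≃⟨ ℚ.toℚᵘ-fromℚᵘ (ℚᵘ.mkℚᵘ (ℤ.+ l) 0) ⟨
  toℚᵘ (fromℕ l)        ∎)
  where open ℚᵘ.≤-Reasoning

fromℕ-injective : ∀ {k l} → fromℕ k ≡ fromℕ l → k ≡ l
fromℕ-injective {k} {l} eq
  with ℚᵘ.*≡* k*1≡l*1 ← ℚ.fromℚᵘ-injective {ℚᵘ.mkℚᵘ (ℤ.+ k) 0} {ℚᵘ.mkℚᵘ (ℤ.+ l) 0} eq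
  = ℤ.+-injective (ℤ.*-cancelʳ-≡ _ _ (ℤ.+ 1) k*1≡l*1)

½*fromℕ[2*k] : ∀ k → ½ ℚ.* fromℕ (2 * k) ≡ fromℕ k
½*fromℕ[2*k] k = ℚ.toℚᵘ-injective (begin-equality
  toℚᵘ (½ ℚ.* fromℕ (2 * k))                ≃⟨ ℚ.toℚᵘ-homo-* ½ (fromℕ (2 * k)) ⟩
  toℚᵘ ½ ℚᵘ.* toℚᵘ (fromℕ (2 * k))          ≃⟨ ℚᵘ.*-congˡ {toℚᵘ ½} (ℚ.toℚᵘ-fromℚᵘ (ℚᵘ.mkℚᵘ (ℤ.+ (2 * k)) 0)) ⟩
  toℚᵘ ½ ℚᵘ.* ℚᵘ.mkℚᵘ (ℤ.+ (2 * k)) 0       ≃⟨ ℚᵘ.*≡* half ⟩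
  ℚᵘ.mkℚᵘ (ℤ.+ k) 0                         ≃⟨ ℚ.toℚᵘ-fromℚᵘ (ℚᵘ.mkℚᵘ (ℤ.+ k) 0) ⟨
  toℚᵘ (fromℕ k)                            ∎)
  where
  open ℚᵘ.≤-Reasoning
  half : (ℤ.+ 1 ℤ.* ℤ.+ (2 * k)) ℤ.* ℤ.+ 1 ≡ ℤ.+ k ℤ.* ℤ.+ 2
  half = trans (ℤ.*-identityʳ _) (trans (ℤ.*-identityˡ _)
    (trans (cong ℤ.+_ (*-comm 2 k)) (ℤ.pos-* k 2)))

½-lower : ∀ s t → 2 * s ≤ t → ½ ℚ.* fromℕ t ≥ℚ fromℕ s
½-lower s t 2s≤t = subst (ℚ._≤ ½ ℚ.* fromℕ t) (½*fromℕ[2*k] s)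
  (ℚ.*-monoˡ-≤-nonNeg ½ (fromℕ-mono-≤ 2s≤t))

-- Multiplication by ½ reflects ≤, and antisymmetry turns this into cancellation.
½-injective : ∀ s t → ½ ℚ.* fromℕ t ≡ fromℕ s → t ≡ 2 * s
½-injective s t eq = fromℕ-injective (ℚ.≤-antisym (½-cancel (ℚ.≤-reflexive ½t≡½2s))
                                                       (½-cancel (ℚ.≤-reflexive (sym ½t≡½2s))))
  where
  ½-cancel : ∀ {p q} → ½ ℚ.* p ℚ.≤ ½ ℚ.* q → p ℚ.≤ q
  ½-cancel = ℚ.*-cancelˡ-≤-pos ½
  ½t≡½2s : ½ ℚ.* fromℕ t ≡ ½ ℚ.* fromℕ (2 * s)
  ½t≡½2s = trans eq (sym (½*fromℕ[2*k] s))

-- Irregularity and degree sequence in terms of the degree list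

module _ {n : ℕ} (G : Graph n) where

  degrees : List ℕ
  degrees = map (degree G) (allFin n)

  length-degrees : length degrees ≡ n
  length-degrees = trans (length-map (degree G) (allFin n)) (length-tabulate (λ i → i))

  irrₜ≡½spread : irrₜ G ≡ ½ ℚ.* fromℕ (spread degrees)
  irrₜ≡½spread = cong (λ s → ½ ℚ.* fromℕ s) (begin
    sum (map _ (cartesianProduct V V))                   ≡⟨ ∑-cartesianProduct _ V V ⟩
    ∑ V (λ x → ∑ V (λ y → ∣ degree G x - degree G y ∣))  ≡⟨ ∑-cong V (λ x → ∑-map ∣ degree G x -_∣ (degree G) V) ⟨
    ∑ V (λ x → ∑ degrees ∣ degree G x -_∣)               ≡⟨ ∑-map _ (degree G) V ⟨
    spread degrees                                       ∎)
    where
    open ≡-Reasoning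
    V = allFin n

  -- Sorting only permutes, and two sorted permutations of one list coincide; `extremal n` is sorted
  -- already.
  degreeSequence≡extremal⇔ : (degreeSequence G ≡ extremal n) ⇔ (degrees ↭ extremal n)
  degreeSequence≡extremal⇔ = mk⇔
    (λ seq≡ → subst (degrees ↭_) seq≡ (↭-sym (sort-↭ degrees)))
    (λ deg↭ → Pointwise-≡⇒≡ (↗↭↗⇒≋ (DecTotalOrder.totalOrder ≥-decTotalOrder) (sort-↗ degrees) (extremal↗ n)
                 (↭⇒↭ₛ (↭-trans (sort-↭ degrees) deg↭))))
    where open Sort ≥-decTotalOrder using (sort-↭; sort-↗)

-- Connected 2-regular graphs are cycles

-- The adjacency of `cycle`, usable on `Fin m` while the period m of a closed walk is still unknown.
NextTo : ∀ {n} → Fin n → Fin n → Set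
NextTo i j = Next i j ⊎ Next j i

next-functional : ∀ {n} {i j k : Fin n} → Next i j → Next i k → j ≡ k
next-functional {j = j} {k} p q = Fin.toℕ-injective (go p q)
  where
  go : Next _ j → Next _ k → toℕ j ≡ toℕ k
  go (inj₁ j≡)       (inj₁ k≡)       = trans j≡ (sym k≡)
  go (inj₁ j≡)       (inj₂ (n≡ , _)) = contradiction (trans j≡ n≡) (<⇒≢ (Fin.toℕ<n j))
  go (inj₂ (n≡ , _)) (inj₁ k≡)       = contradiction (trans k≡ n≡) (<⇒≢ (Fin.toℕ<n k))
  go (inj₂ (_ , j≡)) (inj₂ (_ , k≡)) = trans j≡ (sym k≡)

next-injective : ∀ {n} {i j k : Fin n} → Next j i → Next k i → j ≡ k
next-injective {j = j} {k} p q = Fin.toℕ-injective (suc-injective (go p q))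
  where
  go : Next j _ → Next k _ → suc (toℕ j) ≡ suc (toℕ k)
  go (inj₁ i≡)       (inj₁ i≡′)       = trans (sym i≡) i≡′
  go (inj₁ i≡)       (inj₂ (_ , i≡0)) = contradiction (trans (sym i≡0) i≡) 0≢1+n
  go (inj₂ (_ , i≡0)) (inj₁ i≡)       = contradiction (trans (sym i≡0) i≡) 0≢1+n
  go (inj₂ (j≡ , _)) (inj₂ (k≡ , _))  = trans j≡ (sym k≡)

-- Two increments contradict the order, an increment and a wrap-around give n = 2, and two
-- wrap-arounds give n = 1.
next-asym : ∀ {n} → 3 ≤ n → {i j : Fin n} → Next i j → ¬ Next j i
next-asym _ {i} {j} (inj₁ j≡) (inj₁ i≡) =
  <-asym (≤-reflexive (sym j≡)) (≤-reflexive (sym i≡))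
next-asym 3≤n (inj₁ j≡) (inj₂ (n≡ , i≡0)) =
  <⇒≢ 3≤n (trans (cong suc (sym (trans j≡ (cong suc i≡0)))) n≡)
next-asym 3≤n (inj₂ (n≡ , j≡0)) (inj₁ i≡) =
  <⇒≢ 3≤n (trans (cong suc (sym (trans i≡ (cong suc j≡0)))) n≡)
next-asym 3≤n (inj₂ (n≡ , j≡0)) (inj₂ (_ , i≡0)) =
  <⇒≢ (<-trans (n<1+n 1) 3≤n) (trans (cong suc (sym i≡0)) n≡)

next-total : ∀ {n} (i : Fin n) → ∃[ j ] Next i j
next-total {n@(suc _)} i with suc (toℕ i) ≟ n
... | yes 1+i≡n = zero , inj₂ (1+i≡n , refl)
... | no  1+i≢n = fromℕ< 1+i<n , inj₁ (Fin.toℕ-fromℕ< 1+i<n)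
  where 1+i<n = ≤∧≢⇒< (Fin.toℕ<n i) 1+i≢n

next-surjective : ∀ {n} (i : Fin n) → ∃[ j ] Next j i
next-surjective {suc n} zero    = Fin.fromℕ n , inj₂ (cong suc (Fin.toℕ-fromℕ n) , refl)
next-surjective {suc n} (suc i) = Fin.inject₁ i , inj₁ (cong suc (sym (Fin.toℕ-inject₁ i)))

-- Vertices of degree two

module _ {n : ℕ} (G : Graph n) where

  -- The pair is ordered so that `a` can be where a walk comes from and `b` where it goes next.
  record Neighbours (v a b : Fin n) : Set where
    constructor nbrs
    field
      distinct : a ≢ b
      adj₁     : Adj G v a
      adj₂     : Adj G v b
      only     : ∀ {x} → Adj G v x → x ≡ a ⊎ x ≡ b

  open Neighbours public

  Neighbours-swap : ∀ {v a b} → Neighbours v a b → Neighbours v b a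
  Neighbours-swap (nbrs a≢b va vb only) = nbrs (≢-sym a≢b) vb va (λ vx → swap (only vx))

  Neighbours⇒degree≡2 : ∀ {v a b} → Neighbours v a b → degree G v ≡ 2
  Neighbours⇒degree≡2 {v} {a} {b} N =
    -- Duplicate-free lists with the same members are permutations of each other, hence equally
    -- long.
    ↭-length (∼bag⇒↭ (unique∧set⇒bag (filter⁺ (adj? G v) (allFin⁺ n))
                                     ((distinct N ∷ []) ∷ [] ∷ [])
                                     (mk⇔ to from)))
    where
    to : ∀ {x} → x ∈ filter (adj? G v) (allFin n) → x ∈ a ∷ b ∷ []
    to x∈ with only N (proj₂ (∈-filter⁻ (adj? G v) {xs = allFin n} x∈))
    ... | inj₁ refl = here refl
    ... | inj₂ refl = there (here refl)
    from : ∀ {x} → x ∈ a ∷ b ∷ [] → x ∈ filter (adj? G v) (allFin n)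
    from (here refl)         = ∈-filter⁺ (adj? G v) (∈-allFin a) (adj₁ N)
    from (there (here refl)) = ∈-filter⁺ (adj? G v) (∈-allFin b) (adj₂ N)

  degree≡2⇒Neighbours : ∀ {v} → degree G v ≡ 2 → ∃₂ (Neighbours v)
  degree≡2⇒Neighbours {v} =
    go (filter⁺ (adj? G v) (allFin⁺ n))
       (λ x∈ → proj₂ (∈-filter⁻ (adj? G v) {xs = allFin n} x∈))
       (∈-filter⁺ (adj? G v) (∈-allFin _))
    where
    -- The filtered list is abstracted to `xs`, so that matching on its length exposes the two
    -- neighbours.
    go : ∀ {xs} → Unique xs → (∀ {x} → x ∈ xs → Adj G v x) → (∀ {x} → Adj G v x → x ∈ xs) →
         length xs ≡ 2 → ∃₂ (Neighbours v)
    go {a ∷ b ∷ []} ((a≢b ∷ []) ∷ _) adj mem refl =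
      a , b , nbrs a≢b (adj (here refl)) (adj (there (here refl))) only′
      where
      only′ : ∀ {x} → Adj G v x → x ≡ a ⊎ x ≡ b
      only′ vx with mem vx
      ... | here x≡a         = inj₁ x≡a
      ... | there (here x≡b) = inj₂ x≡b

  otherNeighbour : ∀ {v p} → degree G v ≡ 2 → Adj G v p → ∃[ q ] Neighbours v p q
  otherNeighbour deg≡2 vp with degree≡2⇒Neighbours deg≡2
  ... | a , b , N with only N vp
  ...   | inj₁ refl = b , N
  ...   | inj₂ refl = a , Neighbours-swap N

  -- The two neighbours are the preimages of the successor and predecessor of the image of v,
  -- distinct by `next-asym`.
  ≅cycle⇒degree≡2 : (3≤n : 3 ≤ n) → G ≅ cycle n 3≤n → ∀ v → degree G v ≡ 2
  ≅cycle⇒degree≡2 3≤n iso v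
    with next-total (bijection iso ⟨$⟩ʳ v) | next-surjective (bijection iso ⟨$⟩ʳ v)
    where open _≅_
  ... | j , πv→j | i , i→πv = Neighbours⇒degree≡2 (nbrs a≢b (adj (inj₁ πv→j)) (adj (inj₂ i→πv)) only′)
    where
    open _≅_ iso renaming (bijection to π)
    a = π ⟨$⟩ˡ j
    b = π ⟨$⟩ˡ i
    a≢b : a ≢ b
    a≢b a≡b = next-asym 3≤n πv→j (subst (λ k → Next k (π ⟨$⟩ʳ v)) (sym j≡i) i→πv)
      where
      j≡i : j ≡ i
      j≡i = trans (sym (inverseʳ π)) (trans (cong (π ⟨$⟩ʳ_) a≡b) (inverseʳ π))
    adj : ∀ {k} → NextTo (π ⟨$⟩ʳ v) k → Adj G v (π ⟨$⟩ˡ k)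
    adj πv~k = Equivalence.from (adj⇔ v _) (subst (NextTo (π ⟨$⟩ʳ v)) (sym (inverseʳ π)) πv~k)
    only′ : ∀ {x} → Adj G v x → x ≡ a ⊎ x ≡ b
    only′ {x} vx with Equivalence.to (adj⇔ v x) vx
    ... | inj₁ πv→πx = inj₁ (trans (sym (inverseˡ π)) (cong (π ⟨$⟩ˡ_) (next-functional πv→πx πv→j)))
    ... | inj₂ πx→πv = inj₂ (trans (sym (inverseˡ π)) (cong (π ⟨$⟩ˡ_) (next-injective πx→πv i→πv)))

  -- Non-backtracking walks return to their start

  module NonBacktrackingWalk (w : ℕ → Fin n)
                             (step : ∀ k → Neighbours (w (1 + k)) (w k) (w (2 + k))) where

    adj-suc : ∀ k → Adj G (w k) (w (suc k))
    adj-suc k = adj-sym G (adj₁ (step k))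

    Fresh : ℕ → Set
    Fresh k = ∀ {i j} → i < j → j < k → w i ≢ w j

    -- If wₖ = wᵢ with 0 < i < k then wₖ₋₁ is wᵢ₋₁ or wᵢ₊₁: an earlier coincidence, unless
    -- k − i ≤ 2, which a non-backtracking walk in a loopless graph excludes.
    extend : ∀ {k} → Fresh k → w k ≢ w 0 → Fresh (suc k)
    extend {k} fresh wk≢w0 {i} {j} i<j j<1+k with j ≟ k
    ... | no j≢k = fresh i<j (≤∧≢⇒< (s≤s⁻¹ j<1+k) j≢k)
    extend fresh wk≢w0 {zero}  {_}     i<j j<1+k | yes refl = ≢-sym wk≢w0
    extend fresh wk≢w0 {suc i} {suc j} i<j j<1+k | yes refl = λ wi≡wj → bad i<j wi≡wj
      where
      bad : suc i < suc j → w (suc i) ≢ w (suc j)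
      bad 1+i<1+j wi≡wj
        with only (step i) (subst (λ v → Adj G v (w j)) (sym wi≡wj) (adj₁ (step j)))
      ... | inj₁ wj≡wi = fresh (s<s⁻¹ 1+i<1+j) (n<1+n j) (sym wj≡wi)
      ... | inj₂ wj≡w2+i with <-cmp (2 + i) j
      ...   | tri< 2+i<j _ _  = fresh 2+i<j (n<1+n j) (sym wj≡w2+i)
      ...   | tri≈ _ refl _   = distinct (step (suc i)) wi≡wj
      ...   | tri> _ _ j<2+i with ≤-antisym (s≤s⁻¹ j<2+i) (s<s⁻¹ 1+i<1+j)
      ...     | refl = adj-irrefl G (subst (Adj G (w j)) (sym wj≡w2+i) (adj-suc j))

    -- The distinct prefix grows until the walk meets w 0; without such a return n + 1 vertices
    -- would be distinct, against the pigeonhole principle.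
    closes : ∃[ m ] 0 < m × Fresh m × w m ≡ w 0
    closes with search n
      where
      search : ∀ k → (∃[ m ] 0 < m × Fresh m × w m ≡ w 0) ⊎ Fresh (suc k)
      -- A single vertex is vacuously fresh: no i < j exists below 1.
      search zero    = inj₂ λ { {j = zero} () _ ; {j = suc _} _ (s≤s ()) }
      search (suc k) with search k
      ... | inj₁ found = inj₁ found
      ... | inj₂ fresh with w (suc k) Fin.≟ w 0
      ...   | yes w≡w0 = inj₁ (suc k , z<s , fresh , w≡w0)
      ...   | no  w≢w0 = inj₂ (extend fresh w≢w0)
    ... | inj₁ found = found
    ... | inj₂ fresh with Fin.pigeonhole (n<1+n n) (λ i → w (toℕ i))
    ...   | i , j , i<j , wi≡wj = contradiction wi≡wj (fresh i<j (Fin.toℕ<n j))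

    -- A closed walk as a cyclic enumeration of the vertices

    module Closed {m : ℕ} (0<m : 0 < m) (fresh : Fresh m) (wm≡w0 : w m ≡ w 0) where

      f : Fin m → Fin n
      f i = w (toℕ i)

      f-injective : ∀ {i j} → f i ≡ f j → i ≡ j
      f-injective {i} {j} fi≡fj with <-cmp (toℕ i) (toℕ j)
      ... | tri< i<j _ _ = contradiction fi≡fj (fresh i<j (Fin.toℕ<n j))
      ... | tri≈ _ i≡j _ = Fin.toℕ-injective i≡j
      ... | tri> _ _ j<i = contradiction (sym fi≡fj) (fresh j<i (Fin.toℕ<n i))

      f-next : ∀ {i j} → Next i j → f j ≡ w (suc (toℕ i))
      f-next (inj₁ j≡1+i)         = cong w j≡1+i
      -- At the wrap-around the closing equation w m = w 0 is used.
      f-next (inj₂ (1+i≡m , j≡0)) = trans (cong w j≡0) (trans (sym wm≡w0) (cong w (sym 1+i≡m)))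

      nextTo⇒adj : ∀ {i j} → NextTo i j → Adj G (f i) (f j)
      nextTo⇒adj = [ next⇒adj , (λ j→i → adj-sym G (next⇒adj j→i)) ]′
        where
        next⇒adj : ∀ {i j} → Next i j → Adj G (f i) (f j)
        next⇒adj {i} i→j = subst (Adj G (f i)) (sym (f-next i→j)) (adj-suc (toℕ i))

      -- Period 1 would be a loop, and period 2 an immediate backtrack.
      3≤m : 3 ≤ m
      3≤m = go 0<m wm≡w0
        where
        go : ∀ {m} → 0 < m → w m ≡ w 0 → 3 ≤ m
        go {1} _ w1≡w0 = contradiction (subst (Adj G (w 0)) w1≡w0 (adj-suc 0)) (adj-irrefl G)
        go {2} _ w2≡w0 = contradiction (sym w2≡w0) (distinct (step 0))
        go {suc (suc (suc _))} _ _ = s≤s (s≤s (s≤s z≤n))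

      -- Writing f i as w (p + 1), with p the cyclic predecessor of i, shows its only neighbours to
      -- be w p and w (p + 2), that is, f p and f s.
      adj⇒nextTo : ∀ i {x} → Adj G (f i) x → ∃[ j ] f j ≡ x × NextTo i j
      adj⇒nextTo i {x} ix with next-surjective i | next-total i
      ... | p , p→i | s , i→s = go
        where
        fi≡ : f i ≡ w (suc (toℕ p))
        fi≡ = f-next p→i
        N = step (toℕ p)
        -- As a neighbour of f i, f s is f p or w (p + 2); the former would make p both predecessor
        -- and successor of i.
        fs≡ : f s ≡ w (2 + toℕ p)
        fs≡ with only N (subst (λ v → Adj G v (f s)) fi≡ (nextTo⇒adj (inj₁ i→s)))
        ... | inj₁ fs≡fp  = contradiction p→i
                (next-asym 3≤m (subst (Next i) (f-injective fs≡fp) i→s))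
        ... | inj₂ fs≡w2+p = fs≡w2+p
        go : ∃[ j ] f j ≡ x × NextTo i j
        go with only N (subst (λ v → Adj G v x) fi≡ ix)
        ... | inj₁ x≡fp = p , sym x≡fp , inj₂ p→i
        ... | inj₂ x≡w2+p = s , trans fs≡ (sym x≡w2+p) , inj₁ i→s

      -- The image of `f` contains w 0 and is closed under adjacency, so connectedness makes it
      -- everything.
      f-surjective : Connected G → ∀ x → ∃[ j ] f j ≡ x
      f-surjective conn x = reach (origin , cong w (Fin.toℕ-fromℕ< 0<m)) (conn (w 0) x)
        where
        origin = fromℕ< 0<m
        reach : ∀ {u v} → ∃[ i ] f i ≡ u → Star (Adj G) u v → ∃[ j ] f j ≡ v
        reach found        ε          = found
        reach (i , refl) (uv ◅ vw) with adj⇒nextTo i uv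
        ... | j , fj≡v , _ = reach (j , fj≡v) vw

      -- There are injections both ways: `f`, and a section of it chosen by surjectivity.
      m≡n : Connected G → m ≡ n
      m≡n conn = Fin.cantor-schröder-bernstein {f = f} {g = λ x → proj₁ (f-surjective conn x)}
        f-injective
        (λ {x} {y} gx≡gy → trans (sym (proj₂ (f-surjective conn x)))
                           (trans (cong f gx≡gy) (proj₂ (f-surjective conn y))))

  -- The isomorphism sends a vertex to its index, so it is the inverse `g` of the enumeration.
  cyclicEnumeration⇒≅cycle :
    (3≤n : 3 ≤ n) (f : Fin n → Fin n) →
    (∀ {i j} → f i ≡ f j → i ≡ j) → (∀ x → ∃[ i ] f i ≡ x) →
    (∀ {i j} → NextTo i j → Adj G (f i) (f j)) →
    (∀ i {x} → Adj G (f i) x → ∃[ j ] f j ≡ x × NextTo i j) →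
    G ≅ cycle n 3≤n
  cyclicEnumeration⇒≅cycle 3≤n f inj surj nextTo⇒adj adj⇒nextTo = record
    { bijection = permutation g f gf≡id fg≡id
    ; adj⇔      = λ u v → mk⇔ (to u v)
        (λ gu~gv → subst₂ (Adj G) (fg≡id u) (fg≡id v) (nextTo⇒adj gu~gv))
    }
    where
    g : Fin n → Fin n
    g x = proj₁ (surj x)
    fg≡id : ∀ x → f (g x) ≡ x
    fg≡id x = proj₂ (surj x)
    gf≡id : ∀ i → g (f i) ≡ i
    gf≡id i = inj (fg≡id (f i))
    to : ∀ u v → Adj G u v → NextTo (g u) (g v)
    to u v uv with adj⇒nextTo (g u) (subst (λ z → Adj G z v) (sym (fg≡id u)) uv)
    ... | j , refl , gu~j = subst (NextTo (g u)) (sym (gf≡id j)) gu~j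

  -- The walk in a connected 2-regular graph

  module _ (2-regular : ∀ v → degree G v ≡ 2) where

    -- The state of the walk is a directed edge: its tail must be remembered in order not to turn
    -- back.
    Arc : Set
    Arc = ∃₂ (Adj G)

    advance : Arc → Arc
    advance (u , v , uv) with otherNeighbour (2-regular v) (adj-sym G uv)
    ... | q , N = v , q , adj₂ N

    arc : Arc → ℕ → Arc
    arc a zero    = a
    arc a (suc k) = advance (arc a k)

    walk : Arc → ℕ → Fin n
    walk a k = proj₁ (arc a k)

    walk-step : ∀ a k → Neighbours (walk a (1 + k)) (walk a k) (walk a (2 + k))
    walk-step a k with arc a k
    ... | u , v , uv with otherNeighbour (2-regular v) (adj-sym G uv)
    ...   | q , N = N

    2-regular⇒≅cycle : (3≤n : 3 ≤ n) → Connected G → G ≅ cycle n 3≤n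
    -- `3 ≤ n` unfolds to 2 < n, so the walk starts at vertex 2, towards one of its neighbours.
    2-regular⇒≅cycle 3≤n conn with degree≡2⇒Neighbours (2-regular (fromℕ< 3≤n))
    ... | q , _ , N = conclude closes
      where
      a : Arc
      a = fromℕ< 3≤n , q , adj₁ N
      open NonBacktrackingWalk (walk a) (walk-step a)
      conclude : (∃[ m ] 0 < m × Fresh m × walk a m ≡ walk a 0) → G ≅ cycle n 3≤n
      conclude (m , 0<m , fresh , wm≡w0) with Closed.m≡n 0<m fresh wm≡w0 conn
      -- Identifying m with n turns `f` into an enumeration by `Fin n`.
      ... | refl = cyclicEnumeration⇒≅cycle 3≤n f f-injective (f-surjective conn)
                     nextTo⇒adj adj⇒nextTo
        where open Closed 0<m fresh wm≡w0

-- Bounds and equality cases for unicyclic graphs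

theorem9 : (n : ℕ) (3≤n : 3 ≤ n) (G : Graph n) → Unicyclic G →
    (irrₜ G ≥ℚ 0ℚ × (irrₜ G ≡ 0ℚ ⇔ G ≅ cycle n 3≤n))
    ×
    (4 ≤ n → ¬ (G ≅ cycle n 3≤n) →
    irrₜ G ≥ℚ fromℕ (2 * n ∸ 2)
    × (irrₜ G ≡ fromℕ (2 * n ∸ 2)
    ⇔ degreeSequence G ≡ 3 ∷ replicate (n ∸ 2) 2 ++ 1 ∷ []))
theorem9 n 3≤n G (conn , ∣E∣≡n) =
    ( subst (_≥ℚ 0ℚ) (sym irr≡) (½-lower 0 (spread ds) z≤n)
    , mk⇔ (λ irr≡0 → 2-regular⇒≅cycle G (deficit≡0⇒2-regular (spread≡0⇒deficit≡0 (irr≡⇒ 0 irr≡0)))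
                                        3≤n conn)
          (λ iso → ⇒irr≡ 0 (spread-const (degree G) (allFin n) (≅cycle⇒degree≡2 G 3≤n iso)))
    )
  , λ _ G≇C → let gap = spread-gap′ G≇C in
      subst (_≥ℚ fromℕ (2 * n ∸ 2)) (sym irr≡)
        (½-lower (2 * n ∸ 2) (spread ds) ([ <⇒≤ , (λ ds↭ → ≤-reflexive (sym (↭extremal⇒ ds↭))) ]′ gap))
    , mk⇔ (λ irr≡2n-2 → Equivalence.from (degreeSequence≡extremal⇔ G)
             ([ (λ lt → contradiction (sym (irr≡⇒ (2 * n ∸ 2) irr≡2n-2)) (<⇒≢ lt)) , id ]′ gap))
          (λ seq≡ → ⇒irr≡ (2 * n ∸ 2) (↭extremal⇒ (Equivalence.to (degreeSequence≡extremal⇔ G) seq≡)))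
  where
  ds : List ℕ
  ds = degrees G

  2≤n : 2 ≤ n
  2≤n = ≤-trans (n≤1+n 2) 3≤n

  irr≡ : irrₜ G ≡ ½ ℚ.* fromℕ (spread ds)
  irr≡ = irrₜ≡½spread G

  irr≡⇒ : ∀ s → irrₜ G ≡ fromℕ s → spread ds ≡ 2 * s
  irr≡⇒ s irr≡s = ½-injective s (spread ds) (trans (sym irr≡) irr≡s)

  ⇒irr≡ : ∀ s → spread ds ≡ 2 * s → irrₜ G ≡ fromℕ s
  ⇒irr≡ s spread≡ = trans irr≡ (trans (cong (λ t → ½ ℚ.* fromℕ t) spread≡) (½*fromℕ[2*k] s))

  -- Mean degree 2: the handshake lemma combined with |E| = n.
  Σ≡ : sum ds ≡ 2 * length ds
  Σ≡ = trans (∑-degree G) (cong (2 *_) (trans ∣E∣≡n (sym (length-degrees G))))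

  ↭extremal⇒ : ds ↭ extremal n → spread ds ≡ 2 * (2 * n ∸ 2)
  ↭extremal⇒ ds↭ = trans (spread-↭ ds↭) (spread-extremal 2≤n)

  deficit≡0⇒2-regular : deficit ds ≡ 0 → ∀ v → degree G v ≡ 2
  deficit≡0⇒2-regular def≡0 v = deficit≡0⇒≡2 Σ≡ def≡0 (∈-map⁺ (degree G) (∈-allFin v))

  -- `spread-lower` bounds n times twice the deficit by 0, and n is positive.
  spread≡0⇒deficit≡0 : spread ds ≡ 0 → deficit ds ≡ 0
  spread≡0⇒deficit≡0 spread≡0
    with m*n≡0⇒m≡0∨n≡0 (length ds) (n≤0⇒n≡0 (subst (length ds * (2 * deficit ds) ≤_) spread≡0 (spread-lower ds Σ≡)))
  ... | inj₁ n≡0 =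
    contradiction (trans (sym (length-degrees G)) n≡0) (≢-sym (<⇒≢ (≤-trans z<s 3≤n)))
  ... | inj₂ 2*def≡0 = m+n≡0⇒m≡0 (deficit ds) 2*def≡0

  -- A graph other than the cycle has nonzero deficit, as deficit 0 means 2-regular and hence, by
  -- connectedness, a cycle.
  spread-gap′ : ¬ (G ≅ cycle n 3≤n) → 2 * (2 * n ∸ 2) < spread ds ⊎ ds ↭ extremal n
  spread-gap′ G≇C = subst (λ k → 2 * (2 * k ∸ 2) < spread ds ⊎ ds ↭ extremal k) (length-degrees G)
    (spread-gap ds (subst (2 ≤_) (sym (length-degrees G)) 2≤n) Σ≡
      (λ def≡0 → G≇C (2-regular⇒≅cycle G (deficit≡0⇒2-regular def≡0) 3≤n conn)))
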